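{- If $G$ is a connected unicyclic graph (i.e. a connected graph whose number of edges equals its number of vertices), then ${\rm gp}(G)\geq {\rm Z}(G)$.
   Context: All graphs are finite and simple. Zero forcing: given a set $S\subseteq V(G)$ of initially black vertices (all others white), the color-change rule turns a white vertex $y$ black if $y$ is the only white neighbor of some black vertex $x$. The zero forcing number ${\rm Z}(G)$ is the minimum size of a set $S$ such that repeated application of the color-change rule eventually turns all vertices of $G$ black. A set $R\subseteq V(G)$ is a general position set if no three vertices of $R$ lie on a common shortest path of $G$; the general position number ${\rm gp}(G)$ is the maximum size of a general position set of $G$. -}

module Defs where

open import Data.Nat using (ℕ; zero; suc; _+_; _≤_; _<ᵇ_)
open import Data.Bool using (Bool; true; false; if_then_else_; _∧_)
open import Data.Fin using (Fin; toℕ)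
open import Data.Fin.Subset using (Subset; _∈_; ∣_∣)
open import Data.List using (List; []; _∷_; map; allFin)
open import Data.Nat.ListAction using (sum)
open import Data.Empty using (⊥)
open import Data.Product using (Σ; ∃; ∃-syntax; _×_; _,_)
open import Data.Sum using (_⊎_)
open import Relation.Binary.PropositionalEquality using (_≡_; _≢_)

record Graph (n : ℕ) : Set where
  field
    adj   : Fin n → Fin n → Bool
    sym   : ∀ u v → adj u v ≡ adj v u
    irrefl : ∀ v → adj v v ≡ false
open Graph public

module _ {n : ℕ} (G : Graph n) where

  Adj : Fin n → Fin n → Set
  Adj u v = adj G u v ≡ true

  data Walk : Fin n → Fin n → ℕ → Set where
    [_]  : (v : Fin n) → Walk v v 0
    _∷ʷ_ : ∀ {u w v k} → Adj u w → Walk w v k → Walk u v (suc k)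

  data OnWalk (x : Fin n) : ∀ {u v k} → Walk u v k → Set where
    here-end : OnWalk x [ x ]
    here     : ∀ {w v k} (e : Adj x w) (p : Walk w v k) → OnWalk x (e ∷ʷ p)
    there    : ∀ {u w v k} (e : Adj u w) (p : Walk w v k) → OnWalk x p → OnWalk x (e ∷ʷ p)

  Connected : Set
  Connected = ∀ u v → ∃[ k ] Walk u v k

  edgeCount : ℕ
  edgeCount = sum (map (λ i → sum (map (λ j →
                if adj G i j ∧ (toℕ i <ᵇ toℕ j) then 1 else 0) (allFin n))) (allFin n))

  ConnectedUnicyclic : Set
  ConnectedUnicyclic = Connected × (edgeCount ≡ n)

  IsGeodesic : ∀ {u v k} → Walk u v k → Set
  IsGeodesic {u} {v} {k} _ = ∀ k' → Walk u v k' → k ≤ k'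

  OnCommonGeodesic : Fin n → Fin n → Fin n → Set
  OnCommonGeodesic x y z =
    Σ (Fin n) λ u → Σ (Fin n) λ v → Σ ℕ λ k → Σ (Walk u v k) λ p →
      IsGeodesic p × OnWalk x p × OnWalk y p × OnWalk z p

  IsGeneralPosition : Subset n → Set
  IsGeneralPosition R = ∀ x y z → x ∈ R → y ∈ R → z ∈ R →
    x ≢ y → y ≢ z → x ≢ z → OnCommonGeodesic x y z → ⊥

  data Black (S : Subset n) : Fin n → Set where
    initial : ∀ {v} → v ∈ S → Black S v
    force   : ∀ {x y} → Black S x → Adj x y →
              (∀ w → Adj x w → w ≢ y → Black S w) → Black S y

  IsZeroForcingSet : Subset n → Set
  IsZeroForcingSet S = ∀ v → Black S v

  IsGPNumber : ℕ → Set
  IsGPNumber k = (∃[ R ] (IsGeneralPosition R × ∣ R ∣ ≡ k))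
               × (∀ R → IsGeneralPosition R → ∣ R ∣ ≤ k)

  IsZNumber : ℕ → Set
  IsZNumber k = (∃[ S ] (IsZeroForcingSet S × ∣ S ∣ ≡ k))
              × (∀ S → IsZeroForcingSet S → k ≤ ∣ S ∣)

{-# OPTIONS --safe #-}
module Submission where

-- Deleting pendant vertices one at a time leaves a connected core C in which the degrees sum
-- to 2|C| and are at least 2, so C is a cycle. Now add the pendant vertices back. A set of
-- leaves is in general position, and a forcing set can be maintained that grows only when the
-- number of leaves does. If the trees of G hang at two cycle vertices w ≠ v at least, then the
-- black leaf below w together with a cycle neighbour of w blackens the whole cycle without a
-- force by v, which saves the leaf first attached below v; hence Z(G) does not exceed the
-- number ℓ of leaves. If all trees hang at one vertex v, then Z(G) ≤ ℓ + 1, and the leaves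
-- together with a cycle vertex other than v are in general position. If G is a cycle, then two
-- adjacent vertices force G, and any two vertices are in general position.

open import Defs
open import Data.Nat using (ℕ; zero; suc; _+_; _*_; _≤_; _<_; _<ᵇ_; z≤n; s≤s)
open import Data.Nat.Properties as ℕ using (module ≤-Reasoning)
open import Data.Nat.ListAction using (sum)
open import Data.Nat.ListAction.Properties using (sum-↭)
open import Data.Nat.Tactic.RingSolver using (solve-∀)
open import Data.Bool using (Bool; true; false; if_then_else_; _∧_)
import Data.Bool.Properties as Bool
open import Data.Fin using (Fin; toℕ; zero; suc)
open import Data.Fin.Properties using (_≟_; toℕ-injective)
open import Data.Fin.Subset as Subset using (Subset; ∣_∣; ⁅_⁆; _∪_; inside; outside)
import Data.Fin.Subset.Properties as Subset
open import Data.Vec using ([]; _∷_)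
open import Data.List using (List; []; _∷_; _++_; map; filter; length; allFin; reverse)
open import Data.List.Properties using (map-cong; length-map; length-tabulate; unfold-reverse)
open import Data.List.Membership.Propositional using (_∈_; _∉_; find)
open import Data.List.Membership.Propositional.Properties
  using (∈-++⁺ˡ; ∈-++⁺ʳ; ∈-++⁻; ∈-∃++; ∈-filter⁺; ∈-filter⁻; ∈-map⁺; ∈-map⁻; ∈-allFin)
open import Data.List.Relation.Unary.All as All using ([]; _∷_)
import Data.List.Relation.Unary.All.Properties as All
open import Data.List.Relation.Unary.AllPairs as AllPairs using ([]; _∷_)
open import Data.List.Relation.Unary.Any as Any using (here; there; any?)
open import Data.List.Relation.Unary.Unique.Propositional using (Unique)
open import Data.List.Relation.Unary.Unique.Propositional.Properties
  using (allFin⁺; filter⁺; Unique[x∷xs]⇒x∉xs)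
open import Data.List.Relation.Binary.Permutation.Propositional
  using (_↭_; ↭⇒↭ₛ; ↭-refl; ↭-sym; ↭-trans; prep; swap)
open import Data.List.Relation.Binary.Permutation.Propositional.Properties
  using (∈-resp-↭; ↭-length; ↭-reverse; shift; map⁺)
import Data.List.Relation.Binary.Permutation.Setoid.Properties as Permutation
open import Data.Empty using (⊥; ⊥-elim)
open import Data.Product using (∃; ∃₂; _×_; _,_; proj₁; proj₂)
open import Data.Sum using (_⊎_; inj₁; inj₂)
open import Function using (_∘_; id; case_of_)
open import Relation.Nullary using (¬_; yes; no; contradiction)
open import Relation.Binary.PropositionalEquality as ≡
  using (_≡_; _≢_; refl; cong; subst; subst₂; module ≡-Reasoning)

private
  variable
    A B : Set

-- Finite sums over lists.

∑ : List A → (A → ℕ) → ℕ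
∑ xs f = sum (map f xs)

∑-cong : ∀ (xs : List A) {f g : A → ℕ} → (∀ x → f x ≡ g x) → ∑ xs f ≡ ∑ xs g
∑-cong xs f≗g = cong sum (map-cong f≗g xs)

∑-+ : ∀ (xs : List A) (f g : A → ℕ) → ∑ xs (λ x → f x + g x) ≡ ∑ xs f + ∑ xs g
∑-+ []       f g = refl
∑-+ (x ∷ xs) f g rewrite ∑-+ xs f g = lemma (f x) (g x) (∑ xs f) (∑ xs g)
  where
  lemma : ∀ a b c d → a + b + (c + d) ≡ a + c + (b + d)
  lemma = solve-∀

∑-zero : ∀ (xs : List A) {f : A → ℕ} → (∀ {x} → x ∈ xs → f x ≡ 0) → ∑ xs f ≡ 0
∑-zero []       f≡0 = refl
∑-zero (x ∷ xs) f≡0 rewrite f≡0 (here refl) = ∑-zero xs (f≡0 ∘ there)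

∑-swap : ∀ (xs : List A) (ys : List B) (f : A → B → ℕ) →
         ∑ xs (λ x → ∑ ys (f x)) ≡ ∑ ys (λ y → ∑ xs (λ x → f x y))
∑-swap []       ys f = ≡.sym (∑-zero ys (λ _ → refl))
∑-swap (x ∷ xs) ys f rewrite ∑-swap xs ys f =
  ≡.sym (∑-+ ys (f x) (λ y → ∑ xs (λ x′ → f x′ y)))

∑-≥ : ∀ (xs : List A) {f : A → ℕ} {c} → (∀ {x} → x ∈ xs → c ≤ f x) → length xs * c ≤ ∑ xs f
∑-≥ []       c≤f = z≤n
∑-≥ (x ∷ xs) c≤f = ℕ.+-mono-≤ (c≤f (here refl)) (∑-≥ xs (c≤f ∘ there))

-- A term above `c` would have to be balanced by one below `c`, and there is none.
∑-tight : ∀ (xs : List A) {f : A → ℕ} {c} → (∀ {x} → x ∈ xs → c ≤ f x) →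
          ∑ xs f ≡ length xs * c → ∀ {x} → x ∈ xs → f x ≡ c
∑-tight (x ∷ xs) {f} {c} c≤f eq = λ where
    (here refl) → fx≡c
    (there x∈)  → ∑-tight xs (c≤f ∘ there) rest x∈
  where
  fx≡c : f x ≡ c
  fx≡c = ℕ.≤-antisym
    (ℕ.+-cancelʳ-≤ (length xs * c) (f x) c
      (ℕ.≤-trans (ℕ.+-monoʳ-≤ (f x) (∑-≥ xs (c≤f ∘ there))) (ℕ.≤-reflexive eq)))
    (c≤f (here refl))
  rest : ∑ xs f ≡ length xs * c
  rest = ℕ.+-cancelˡ-≡ c _ _ (≡.trans (cong (_+ ∑ xs f) (≡.sym fx≡c)) eq)

-- Repetition-free lists and the subsets they represent.

Unique-resp-↭ : ∀ {xs ys : List A} → xs ↭ ys → Unique xs → Unique ys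
Unique-resp-↭ {A} p = Permutation.Unique-resp-↭ (≡.setoid A) (↭⇒↭ₛ p)

pull : ∀ {x : A} {xs} → x ∈ xs → ∃ λ xs′ → xs ↭ x ∷ xs′
pull x∈xs with ys , zs , refl ← ∈-∃++ x∈xs = ys ++ zs , shift _ ys zs

Unique-++⇒≢ : ∀ {xs ys : List A} → Unique (xs ++ ys) → ∀ {x y} → x ∈ xs → y ∈ ys → x ≢ y
Unique-++⇒≢ {xs = x ∷ xs} (x∉ ∷ _)    (here refl) y∈ = All.lookup x∉ (∈-++⁺ʳ xs y∈)
Unique-++⇒≢ {xs = x ∷ xs} (_ ∷ uniq) (there x∈)  y∈ = Unique-++⇒≢ uniq x∈ y∈

Unique-++ʳ : ∀ (xs : List A) {ys} → Unique (xs ++ ys) → Unique ys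
Unique-++ʳ []       uniq       = uniq
Unique-++ʳ (x ∷ xs) (_ ∷ uniq) = Unique-++ʳ xs uniq

Unique-++ˡ : ∀ {xs ys : List A} → Unique (xs ++ ys) → Unique xs
Unique-++ˡ {xs = []}     _           = []
Unique-++ˡ {xs = x ∷ xs} (x∉ ∷ uniq) = All.++⁻ˡ xs x∉ ∷ Unique-++ˡ uniq

fromList : ∀ {n} → List (Fin n) → Subset n
fromList []       = Subset.⊥
fromList (x ∷ xs) = ⁅ x ⁆ ∪ fromList xs

∈-fromList⁺ : ∀ {n} {x : Fin n} {xs} → x ∈ xs → x Subset.∈ fromList xs
∈-fromList⁺ (here refl) = Subset.x∈p∪q⁺ (inj₁ (Subset.x∈⁅x⁆ _))
∈-fromList⁺ (there x∈)  = Subset.x∈p∪q⁺ (inj₂ (∈-fromList⁺ x∈))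

∈-fromList⁻ : ∀ {n} {x : Fin n} xs → x Subset.∈ fromList xs → x ∈ xs
∈-fromList⁻ []       x∈ = ⊥-elim (Subset.∉⊥ x∈)
∈-fromList⁻ (y ∷ xs) x∈ with Subset.x∈p∪q⁻ ⁅ y ⁆ (fromList xs) x∈
... | inj₁ x∈y = here (Subset.x∈⁅y⁆⇒x≡y y x∈y)
... | inj₂ x∈p = there (∈-fromList⁻ xs x∈p)

∣⁅x⁆∪p∣≤1+∣p∣ : ∀ {n} (x : Fin n) (p : Subset n) → ∣ ⁅ x ⁆ ∪ p ∣ ≤ suc ∣ p ∣
∣⁅x⁆∪p∣≤1+∣p∣ zero    (s ∷ p) rewrite Subset.∪-identityˡ p with s
... | inside  = ℕ.n≤1+n _
... | outside = ℕ.≤-refl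
∣⁅x⁆∪p∣≤1+∣p∣ (suc x) (inside ∷ p)  = s≤s (∣⁅x⁆∪p∣≤1+∣p∣ x p)
∣⁅x⁆∪p∣≤1+∣p∣ (suc x) (outside ∷ p) = ∣⁅x⁆∪p∣≤1+∣p∣ x p

∣fromList∣≤length : ∀ {n} (xs : List (Fin n)) → ∣ fromList xs ∣ ≤ length xs
∣fromList∣≤length {n} []   = ℕ.≤-reflexive (Subset.∣⊥∣≡0 n)
∣fromList∣≤length (x ∷ xs) =
  ℕ.≤-trans (∣⁅x⁆∪p∣≤1+∣p∣ x (fromList xs)) (s≤s (∣fromList∣≤length xs))

length≤∣fromList∣ : ∀ {n} {xs : List (Fin n)} → Unique xs → length xs ≤ ∣ fromList xs ∣
length≤∣fromList∣ [] = z≤n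
length≤∣fromList∣ {xs = x ∷ xs} uniq@(_ ∷ uniq′) =
  ℕ.≤-<-trans (length≤∣fromList∣ uniq′) (Subset.p⊂q⇒∣p∣<∣q∣
    ( Subset.q⊆p∪q ⁅ x ⁆ (fromList xs)
    , x , ∈-fromList⁺ {xs = x ∷ xs} (here refl) , Unique[x∷xs]⇒x∉xs uniq ∘ ∈-fromList⁻ xs))

Unique⇒length≤n : ∀ {n} {xs : List (Fin n)} → Unique xs → length xs ≤ n
Unique⇒length≤n {xs = xs} uniq = ℕ.≤-trans (length≤∣fromList∣ uniq) (Subset.∣p∣≤n (fromList xs))

module _ {n : ℕ} (G : Graph n) where

  private
    V = Fin n

  -- Degrees in induced subgraphs and the handshake identity.

  edge : V → V → ℕ
  edge u v = if adj G u v then 1 else 0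

  -- Here and below a list `A` of vertices stands for the subgraph of `G` induced on it; degrees,
  -- neighbours, paths and forcing are taken relative to `A`.
  deg : List V → V → ℕ
  deg A u = ∑ A (edge u)

  nbrs : List V → V → List V
  nbrs A u = filter (λ v → adj G u v Bool.≟ true) A

  deg≡length-nbrs : ∀ A u → deg A u ≡ length (nbrs A u)
  deg≡length-nbrs []      u = refl
  deg≡length-nbrs (v ∷ A) u with adj G u v
  ... | true  = cong suc (deg≡length-nbrs A u)
  ... | false = deg≡length-nbrs A u

  degreeSum : List V → ℕ
  degreeSum A = ∑ A (deg A)

  edge-sym : ∀ u v → edge u v ≡ edge v u
  edge-sym u v rewrite Graph.sym G u v = refl

  Adj-sym : ∀ {u v} → Adj G u v → Adj G v u
  Adj-sym {u} {v} e = ≡.trans (Graph.sym G v u) e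

  Adj⇒≢ : ∀ {u v} → Adj G u v → u ≢ v
  Adj⇒≢ {u} e refl with () ← ≡.trans (≡.sym e) (irrefl G u)

  deg-↭ : ∀ {A B} → A ↭ B → ∀ u → deg A u ≡ deg B u
  deg-↭ p u = sum-↭ (map⁺ (edge u) p)

  degreeSum-↭ : ∀ {A B} → A ↭ B → degreeSum A ≡ degreeSum B
  degreeSum-↭ {A} {B} p = ≡.trans (∑-cong A (deg-↭ p)) (sum-↭ (map⁺ (deg B) p))

  degreeSum-∷ : ∀ y A → degreeSum (y ∷ A) ≡ 2 * deg A y + degreeSum A
  degreeSum-∷ y A = begin
    edge y y + deg A y + ∑ A (λ u → edge u y + deg A u)
      ≡⟨ cong (λ t → t + deg A y + ∑ A (λ u → edge u y + deg A u)) loop ⟩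
    deg A y + ∑ A (λ u → edge u y + deg A u)
      ≡⟨ cong (deg A y +_) (∑-+ A (λ u → edge u y) (deg A)) ⟩
    deg A y + (∑ A (λ u → edge u y) + degreeSum A)
      ≡⟨ cong (λ t → deg A y + (t + degreeSum A)) (∑-cong A (λ u → edge-sym u y)) ⟩
    deg A y + (deg A y + degreeSum A)
      ≡⟨ lemma (deg A y) (degreeSum A) ⟩
    2 * deg A y + degreeSum A ∎
    where
    open ≡-Reasoning
    loop : edge y y ≡ 0
    loop rewrite irrefl G y = refl
    lemma : ∀ a b → a + (a + b) ≡ 2 * a + b
    lemma = solve-∀

  -- An adjacent ordered pair is counted by `up` in exactly one of its two orientations. Exchanging
  -- the sums turns the reversed orientation into a second copy of `edgeCount`.
  handshake : degreeSum (allFin n) ≡ 2 * edgeCount G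
  handshake = begin
    ∑ V* (λ i → ∑ V* (edge i))
      ≡⟨ ∑-cong V* (λ i → ∑-cong V* (split i)) ⟩
    ∑ V* (λ i → ∑ V* (λ j → up i j + up j i))
      ≡⟨ ∑-cong V* (λ i → ∑-+ V* (up i) (λ j → up j i)) ⟩
    ∑ V* (λ i → ∑ V* (up i) + ∑ V* (λ j → up j i))
      ≡⟨ ∑-+ V* (λ i → ∑ V* (up i)) (λ i → ∑ V* (λ j → up j i)) ⟩
    edgeCount G + ∑ V* (λ i → ∑ V* (λ j → up j i))
      ≡⟨ cong (edgeCount G +_) (∑-swap V* V* (λ i j → up j i)) ⟩
    edgeCount G + edgeCount G
      ≡⟨ cong (edgeCount G +_) (ℕ.+-identityʳ _) ⟨
    2 * edgeCount G ∎
    where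
    open ≡-Reasoning
    V* = allFin n
    up : V → V → ℕ
    up i j = if adj G i j ∧ (toℕ i <ᵇ toℕ j) then 1 else 0
    <ᵇ-flip : ∀ a b → a ≢ b → (if a <ᵇ b then 1 else 0) + (if b <ᵇ a then 1 else 0) ≡ 1
    <ᵇ-flip zero    zero    a≢b = contradiction refl a≢b
    <ᵇ-flip zero    (suc b) a≢b = refl
    <ᵇ-flip (suc a) zero    a≢b = refl
    <ᵇ-flip (suc a) (suc b) a≢b = <ᵇ-flip a b (a≢b ∘ cong suc)
    split : ∀ i j → edge i j ≡ up i j + up j i
    split i j rewrite Graph.sym G j i with adj G i j in e
    ... | false = refl
    ... | true  = ≡.sym (<ᵇ-flip (toℕ i) (toℕ j) (Adj⇒≢ e ∘ toℕ-injective))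

  -- Pendant vertices and connectedness of induced subgraphs.

  nbrs⁺ : ∀ {A u v} → v ∈ A → Adj G u v → v ∈ nbrs A u
  nbrs⁺ {u = u} = ∈-filter⁺ (λ v → adj G u v Bool.≟ true)

  nbrs⁻ : ∀ {A u v} → v ∈ nbrs A u → v ∈ A × Adj G u v
  nbrs⁻ {u = u} = ∈-filter⁻ (λ v → adj G u v Bool.≟ true)

  -- Membership of `y` in `A` is left open, so one predicate covers both a leaf of the subgraph and
  -- a vertex about to be attached to it.
  IsPendant : List V → V → Set
  IsPendant A y = ∃ λ x → x ∈ A × Adj G y x × (∀ {u} → u ∈ A → Adj G y u → u ≡ x)

  deg≡1⇒pendant : ∀ {A y} → deg A y ≡ 1 → IsPendant A y
  deg≡1⇒pendant {A} {y} d
    with nbrs A y in eq | ≡.trans (≡.sym (deg≡length-nbrs A y)) d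
  ... | x ∷ [] | _ = x , proj₁ x∈ , proj₂ x∈ , unique
    where
    x∈ : x ∈ A × Adj G y x
    x∈ = nbrs⁻ (subst (x ∈_) (≡.sym eq) (here refl))
    unique : ∀ {u} → u ∈ A → Adj G y u → u ≡ x
    unique u∈A e with here u≡x ← subst (_ ∈_) eq (nbrs⁺ u∈A e) = u≡x

  data Path (A : List V) : V → V → Set where
    stop : ∀ {u} → Path A u u
    step : ∀ {u w v} → Adj G u w → w ∈ A → Path A w v → Path A u v

  PathConnected : List V → Set
  PathConnected A = ∀ {u v} → u ∈ A → v ∈ A → Path A u v

  Path-⊆ : ∀ {A B} → (∀ {u} → u ∈ A → u ∈ B) → ∀ {u v} → Path A u v → Path B u v
  Path-⊆ A⊆B stop         = stop
  Path-⊆ A⊆B (step e w∈ p) = step e (A⊆B w∈) (Path-⊆ A⊆B p)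

  Path-closed : ∀ {A} {P : V → Set} → (∀ {a b} → P a → Adj G a b → b ∈ A → P b) →
                ∀ {u v} → Path A u v → P u → P v
  Path-closed closed stop          Pu = Pu
  Path-closed closed (step e w∈ p) Pu = Path-closed closed p (closed Pu e w∈)

  -- A detour through the pendant vertex y enters and leaves it at its only neighbour.
  remove-pendant : ∀ {A y} → y ∉ A → IsPendant A y → PathConnected (y ∷ A) → PathConnected A
  remove-pendant {A} {y} y∉A (x , x∈A , e , only) conn {v = v} u∈A v∈A =
      proj₁ (shorten (conn (there u∈A) (there v∈A))) u∈A
    where
    shorten : ∀ {u} → Path (y ∷ A) u v → (u ∈ A → Path A u v) × (u ≡ y → Path A x v)
    shorten stop = (λ _ → stop) , λ { refl → contradiction v∈A y∉A }
    shorten (step e′ (here refl) p) =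
      (λ u∈A → subst (λ t → Path A t v) (≡.sym (only u∈A (Adj-sym e′))) (proj₂ (shorten p) refl)) ,
      λ { refl → contradiction refl (Adj⇒≢ e′) }
    shorten (step e′ (there w∈A) p) =
      (λ _ → step e′ w∈A (proj₁ (shorten p) w∈A)) ,
      λ { refl → subst (λ t → Path A t v) (only w∈A e′) (proj₁ (shorten p) w∈A) }

  -- The 2-regular core, reached by deleting pendant vertices.

  -- The degree condition is split in two: `twoNbrs` lets a path be continued, `atMostTwo`
  -- identifies any further neighbour with one already known.
  record IsCore (C : List V) : Set where
    field
      connected : PathConnected C
      distinct  : Unique C
      nonempty  : ∃ λ a → a ∈ C
      twoNbrs   : ∀ {a} → a ∈ C → ∃₂ λ p q → p ≢ q × (p ∈ C × Adj G a p) × (q ∈ C × Adj G a q)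
      atMostTwo : ∀ {a p q r} → a ∈ C → p ∈ C → q ∈ C → r ∈ C →
                  Adj G a p → Adj G a q → Adj G a r → p ≢ q → r ≡ p ⊎ r ≡ q

  -- Keeps the order of the deletions, so that induction puts the pendant vertices back one by one.
  data Grown (C : List V) : List V → Set where
    core : Grown C C
    grow : ∀ {B y} → y ∉ B → IsPendant B y → Grown C B → Grown C (y ∷ B)

  deg≡2⇒core : ∀ {C} → PathConnected C → Unique C → (∃ λ a → a ∈ C) →
               (∀ {a} → a ∈ C → deg C a ≡ 2) → IsCore C
  deg≡2⇒core {C} conn uniq a∈C deg≡2 = record
    { connected = conn
    ; distinct  = uniq
    ; nonempty  = a∈C
    ; twoNbrs   = two
    ; atMostTwo = atMost
    }
    where
    pair : ∀ {a} → a ∈ C → ∃₂ λ p q → p ≢ q × nbrs C a ≡ p ∷ q ∷ []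
    pair {a} a∈ with nbrs C a | filter⁺ (λ v → adj G a v Bool.≟ true) uniq
                   | ≡.trans (≡.sym (deg≡length-nbrs C a)) (deg≡2 a∈)
    ... | p ∷ q ∷ [] | (p≢q ∷ []) ∷ _ | _ = p , q , p≢q , refl
    two : ∀ {a} → a ∈ C → ∃₂ λ p q → p ≢ q × (p ∈ C × Adj G a p) × (q ∈ C × Adj G a q)
    two a∈ with p , q , p≢q , eq ← pair a∈ =
      p , q , p≢q , nbrs⁻ (subst (p ∈_) (≡.sym eq) (here refl))
                  , nbrs⁻ (subst (q ∈_) (≡.sym eq) (there (here refl)))
    pigeon : ∀ {p q r s t : V} → p ∈ s ∷ t ∷ [] → q ∈ s ∷ t ∷ [] → r ∈ s ∷ t ∷ [] →
             p ≢ q → r ≡ p ⊎ r ≡ q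
    pigeon (here refl)         (here refl)         _                   p≢q = contradiction refl p≢q
    pigeon (there (here refl)) (there (here refl)) _                   p≢q = contradiction refl p≢q
    pigeon (here refl)         (there (here refl)) (here refl)         _   = inj₁ refl
    pigeon (here refl)         (there (here refl)) (there (here refl)) _   = inj₂ refl
    pigeon (there (here refl)) (here refl)         (here refl)         _   = inj₂ refl
    pigeon (there (here refl)) (here refl)         (there (here refl)) _   = inj₁ refl
    atMost : ∀ {a p q r} → a ∈ C → p ∈ C → q ∈ C → r ∈ C →
             Adj G a p → Adj G a q → Adj G a r → p ≢ q → r ≡ p ⊎ r ≡ q
    atMost a∈ p∈ q∈ r∈ ep eq er with _ , _ , _ , nbrs≡ ← pair a∈ =
      pigeon (subst (_ ∈_) nbrs≡ (nbrs⁺ p∈ ep)) (subst (_ ∈_) nbrs≡ (nbrs⁺ q∈ eq))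
             (subst (_ ∈_) nbrs≡ (nbrs⁺ r∈ er))

  -- From an isolated vertex every path stops at once, so connectedness makes all degrees zero,
  -- while twice the length of a nonempty list is positive.
  deg≢0 : ∀ {A} → PathConnected A → degreeSum A ≡ 2 * length A → ∀ {a} → a ∈ A → deg A a ≢ 0
  deg≢0 {A} conn sum≡ {a} a∈A d≡0 = absurd a∈A (≡.trans (≡.sym sum≡) (∑-zero A allZero))
    where
    isolated : ∀ {u} → u ∈ A → ¬ Adj G a u
    isolated u∈A e with nbrs A a | nbrs⁺ u∈A e | ≡.trans (≡.sym (deg≡length-nbrs A a)) d≡0
    ... | _ ∷ _ | _ | ()
    allZero : ∀ {u} → u ∈ A → deg A u ≡ 0
    allZero u∈A with conn a∈A u∈A
    ... | stop         = d≡0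
    ... | step e w∈A _ = contradiction e (isolated w∈A)
    absurd : ∀ {xs : List V} → a ∈ xs → 2 * length xs ≢ 0
    absurd {_ ∷ _} _ ()

  -- Deleting a vertex of degree one lowers both the degree sum and twice the number of vertices by
  -- two, so their equality persists. The length `k` is the recursion measure, because the shorter
  -- list is only obtained up to permutation.
  prune : ∀ k A → length A ≡ k → Unique A → (∃ λ a → a ∈ A) → PathConnected A →
          degreeSum A ≡ 2 * length A → ∃₂ λ C B → IsCore C × Grown C B × A ↭ B
  prune k A len uniq a∈A conn sum≡ with any? (λ y → deg A y ℕ.≟ 1) A
  prune zero [] len uniq (_ , ()) conn sum≡ | yes _
  prune (suc k) A len uniq a∈A conn sum≡ | yes pendant
    with y , y∈A , deg≡1 ← find pendant
    with A′ , A↭ ← pull y∈A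
    = let C , B , isCore , grown , A′↭B = prune k A′ len′ uniq′ (_ , x∈A′) conn′ sum′ in
      C , y ∷ B , isCore
        , grow (y∉A′ ∘ ∈-resp-↭ (↭-sym A′↭B))
               (x , ∈-resp-↭ A′↭B x∈A′ , e , only ∘ ∈-resp-↭ (↭-sym A′↭B)) grown
        , ↭-trans A↭ (prep y A′↭B)
    where
    len′ : length A′ ≡ k
    len′ = ℕ.suc-injective (≡.trans (≡.sym (↭-length A↭)) len)
    uniq∷ : Unique (y ∷ A′)
    uniq∷ = Unique-resp-↭ A↭ uniq
    uniq′ : Unique A′
    uniq′ = AllPairs.tail uniq∷
    y∉A′ : y ∉ A′
    y∉A′ = Unique[x∷xs]⇒x∉xs uniq∷
    deg′ : deg A′ y ≡ 1
    deg′ = begin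
      deg A′ y             ≡⟨ cong (_+ deg A′ y) loop ⟨
      deg (y ∷ A′) y       ≡⟨ deg-↭ A↭ y ⟨
      deg A y              ≡⟨ deg≡1 ⟩
      1 ∎
      where
      open ≡-Reasoning
      loop : edge y y ≡ 0
      loop rewrite irrefl G y = refl
    pendant′ : IsPendant A′ y
    pendant′ = deg≡1⇒pendant deg′
    x = proj₁ pendant′
    x∈A′ = proj₁ (proj₂ pendant′)
    e = proj₁ (proj₂ (proj₂ pendant′))
    only : ∀ {u} → u ∈ A′ → Adj G y u → u ≡ x
    only = proj₂ (proj₂ (proj₂ pendant′))
    conn′ : PathConnected A′
    conn′ = remove-pendant y∉A′ pendant′ λ u∈ v∈ →
      Path-⊆ (∈-resp-↭ A↭) (conn (∈-resp-↭ (↭-sym A↭) u∈) (∈-resp-↭ (↭-sym A↭) v∈))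
    sum′ : degreeSum A′ ≡ 2 * length A′
    sum′ = ℕ.+-cancelˡ-≡ 2 _ _ (begin
      2 + degreeSum A′               ≡⟨ cong (λ d → 2 * d + degreeSum A′) deg′ ⟨
      2 * deg A′ y + degreeSum A′    ≡⟨ degreeSum-∷ y A′ ⟨
      degreeSum (y ∷ A′)             ≡⟨ degreeSum-↭ A↭ ⟨
      degreeSum A                    ≡⟨ sum≡ ⟩
      2 * length A                   ≡⟨ cong (2 *_) (↭-length A↭) ⟩
      2 * suc (length A′)            ≡⟨ ℕ.*-suc 2 (length A′) ⟩
      2 + 2 * length A′ ∎)
      where open ≡-Reasoning
  -- Degrees zero and one are both excluded, and the average degree is exactly two, so every degree
  -- is two.
  prune k A len uniq a∈A conn sum≡ | no noPendant =
    A , A , deg≡2⇒core conn uniq a∈A deg≡2 , core , ↭-refl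
    where
    deg≥2 : ∀ {a} → a ∈ A → 2 ≤ deg A a
    deg≥2 {a} a∈ with deg A a in eq
    ... | zero        = contradiction eq (deg≢0 conn sum≡ a∈)
    ... | suc zero    = contradiction (Any.map (λ { refl → eq }) a∈) noPendant
    ... | suc (suc _) = s≤s (s≤s z≤n)
    deg≡2 : ∀ {a} → a ∈ A → deg A a ≡ 2
    deg≡2 = ∑-tight A deg≥2 (≡.trans sum≡ (ℕ.*-comm 2 (length A)))

  -- Chains of vertices and the core as a single cycle.

  data Chain : V → List V → V → Set where
    link : ∀ {a b} → Adj G a b → Chain a [] b
    _◅_  : ∀ {a x xs b} → Adj G a x → Chain x xs b → Chain a (x ∷ xs) b

  infixr 5 _◅_

  Chain-∷ʳ : ∀ {a xs b c} → Chain a xs b → Adj G b c → Chain a (xs ++ b ∷ []) c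
  Chain-∷ʳ (link e) e′ = e ◅ link e′
  Chain-∷ʳ (e ◅ ch) e′ = e ◅ Chain-∷ʳ ch e′

  Chain-reverse : ∀ {a xs b} → Chain a xs b → Chain b (reverse xs) a
  Chain-reverse (link e) = link (Adj-sym e)
  Chain-reverse {xs = x ∷ xs} (e ◅ ch) =
    subst (λ zs → Chain _ zs _) (≡.sym (unfold-reverse x xs)) (Chain-∷ʳ (Chain-reverse ch) (Adj-sym e))

  Chain-split : ∀ {a b u zs} ys → Chain a (ys ++ u ∷ zs) b → Chain a ys u × Chain u zs b
  Chain-split []       (e ◅ ch) = link e , ch
  Chain-split (y ∷ ys) (e ◅ ch) with ch₁ , ch₂ ← Chain-split ys ch = e ◅ ch₁ , ch₂

  Chain-first : ∀ {a xs b} → Chain a xs b → ∃ λ s → s ∈ b ∷ xs × Adj G a s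
  Chain-first (link e) = _ , here refl , e
  Chain-first (e ◅ _)  = _ , there (here refl) , e

  Chain-last : ∀ {a xs b} → Chain a xs b → ∃ λ p → p ∈ a ∷ xs × Adj G b p
  Chain-last (link e) = _ , here refl , Adj-sym e
  Chain-last (_ ◅ ch) with p , p∈ , e ← Chain-last ch = p , there p∈ , e

  -- Splitting the chain at `u` gives a predecessor and a successor; they lie in disjoint pieces of
  -- a repetition-free list, hence differ.
  Chain-interior : ∀ {a xs b u} → Chain a xs b → Unique (a ∷ b ∷ xs) → u ∈ xs →
    ∃₂ λ p s → p ≢ s × (p ∈ a ∷ xs × Adj G u p) × (s ∈ b ∷ xs × Adj G u s)
  Chain-interior {a} {b = b} ch uniq u∈xs
    with ys , zs , refl ← ∈-∃++ u∈xs
    with ch₁ , ch₂ ← Chain-split ys ch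
    with p , p∈ , ep ← Chain-last ch₁ | s , s∈ , es ← Chain-first ch₂
    = p , s , separate uniq p∈ s∈ , (before p∈ , ep) , (after s∈ , es)
    where
    before : ∀ {p} → p ∈ a ∷ ys → p ∈ a ∷ ys ++ _ ∷ zs
    before (here eq)  = here eq
    before (there p∈) = there (∈-++⁺ˡ p∈)
    after : ∀ {s} → s ∈ b ∷ zs → s ∈ b ∷ ys ++ _ ∷ zs
    after (here eq)  = here eq
    after (there s∈) = there (∈-++⁺ʳ ys (there s∈))
    separate : Unique (a ∷ b ∷ ys ++ _ ∷ zs) → ∀ {p s} → p ∈ a ∷ ys → s ∈ b ∷ zs → p ≢ s
    separate ((a≢b ∷ _) ∷ _)          (here refl) (here refl) = a≢b
    separate ((_ ∷ a≢) ∷ _)           (here refl) (there s∈)  =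
      All.lookup a≢ (∈-++⁺ʳ ys (there s∈))
    separate (_ ∷ b≢ ∷ _)             (there p∈)  (here refl) =
      All.lookup b≢ (∈-++⁺ˡ p∈) ∘ ≡.sym
    separate (_ ∷ _ ∷ uniq′)          (there p∈)  (there s∈)  =
      Unique-++⇒≢ uniq′ p∈ (there s∈)

  module _ {C : List V} (isCore : IsCore C) where
    open IsCore isCore

    anotherNbr : ∀ {a} → a ∈ C → ∀ p → ∃ λ u → u ≢ p × u ∈ C × Adj G a u
    anotherNbr a∈C p with x , y , x≢y , (x∈ , ex) , (y∈ , ey) ← twoNbrs a∈C with x ≟ p
    ... | no x≢p   = x , x≢p , x∈ , ex
    ... | yes refl = y , x≢y ∘ ≡.sym , y∈ , ey

    record Cycle (w : V) : Set where
      field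
        {rest} : List V
        chain  : Chain w rest w
        simple : Unique (w ∷ rest)
        rest⊆C : ∀ {u} → u ∈ rest → u ∈ C
        covers : ∀ {u} → u ∈ C → u ∈ w ∷ rest

    -- Every vertex of the closed chain already has two distinct neighbours on it, so by `atMostTwo`
    -- no edge of the core leaves it. Connectedness then makes it the whole core.
    closeCycle : ∀ {w h x xs} → Chain h (x ∷ xs) w → Adj G h w → Unique (h ∷ w ∷ x ∷ xs) →
                 (∀ {u} → u ∈ h ∷ w ∷ x ∷ xs → u ∈ C) → Cycle w
    closeCycle {w} {h} {x} {xs} ch@(ex ◅ ch′) ew uniq@((h≢w ∷ h∉) ∷ w∉ ∷ uniq′) ⊆C = record
      { chain  = Adj-sym ew ◅ ch
      ; simple = (h≢w ∘ ≡.sym ∷ w∉) ∷ h∉ ∷ uniq′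
      ; rest⊆C = λ { (here refl) → ⊆C (here refl) ; (there u∈) → ⊆C (there (there u∈)) }
      ; covers = λ u∈C → Path-closed closed (connected (⊆C (there (here refl))) u∈C) (here refl)
      }
      where
      toC : ∀ {u} → u ∈ w ∷ h ∷ x ∷ xs → u ∈ C
      toC (here refl)         = ⊆C (there (here refl))
      toC (there (here refl)) = ⊆C (here refl)
      toC (there (there u∈))  = ⊆C (there (there u∈))
      within : ∀ {a p q b} → a ∈ w ∷ h ∷ x ∷ xs → p ∈ w ∷ h ∷ x ∷ xs → q ∈ w ∷ h ∷ x ∷ xs → p ≢ q →
               Adj G a p → Adj G a q → b ∈ C → Adj G a b → b ∈ w ∷ h ∷ x ∷ xs
      within a∈ p∈ q∈ p≢q ep eq b∈ eb
        with atMostTwo (toC a∈) (toC p∈) (toC q∈) b∈ ep eq eb p≢q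
      ... | inj₁ refl = p∈
      ... | inj₂ refl = q∈
      closed : ∀ {a b} → a ∈ w ∷ h ∷ x ∷ xs → Adj G a b → b ∈ C → b ∈ w ∷ h ∷ x ∷ xs
      closed a∈@(here refl) e b∈ with p , p∈ , ep ← Chain-last ch′ =
        within a∈ (there (here refl)) (there (there p∈)) (All.lookup h∉ p∈) (Adj-sym ew) ep b∈ e
      closed a∈@(there (here refl)) e b∈ =
        within a∈ (here refl) (there (there (here refl))) (All.lookup w∉ (here refl)) ew ex b∈ e
      closed a∈@(there (there a∈xs)) e b∈
        with p , s , p≢s , (p∈ , ep) , (s∈ , es) ← Chain-interior ch uniq a∈xs =
        within a∈ (there p∈) (skip s∈) p≢s ep es b∈ e
        where
        skip : ∀ {s} → s ∈ w ∷ x ∷ xs → s ∈ w ∷ h ∷ x ∷ xs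
        skip (here eq)  = here eq
        skip (there s∈) = there (there s∈)

    -- The path is prolonged at its end `h`, with `w` fixed, by a neighbour other than the one just
    -- left; that neighbour is either `w`, which closes the cycle, or new. The path has
    -- `2 + length xs` distinct vertices among `n`, so the fuel cannot run out.
    extendToCycle : ∀ fuel {w h xs} → fuel + length xs ≡ n → Chain h xs w → Unique (h ∷ w ∷ xs) →
                    (∀ {u} → u ∈ h ∷ w ∷ xs → u ∈ C) → Cycle w
    extendToCycle zero len ch uniq ⊆C =
      contradiction (ℕ.≤-trans (Unique⇒length≤n uniq) (ℕ.≤-reflexive (≡.sym len)))
                    (ℕ.<⇒≱ (ℕ.m<n⇒m<1+n (ℕ.n<1+n _)))
    extendToCycle (suc fuel) {w} {h} {xs} len ch uniq@((h≢w ∷ h∉) ∷ w∉ ∷ uniq′) ⊆C = next ch refl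
      where
      extend : ∀ {u} → Adj G h u → u ∈ C → u ∉ w ∷ xs → Cycle w
      extend {u} e u∈C u∉ =
        extendToCycle fuel (≡.trans (ℕ.+-suc fuel (length xs)) len) (Adj-sym e ◅ ch)
          (All.¬Any⇒All¬ _ fresh ∷ ((h≢w ∘ ≡.sym) ∷ w∉) ∷ h∉ ∷ uniq′)
          λ { (here refl)                 → u∈C
            ; (there (here refl))         → ⊆C (there (here refl))
            ; (there (there (here refl))) → ⊆C (here refl)
            ; (there (there (there v∈)))  → ⊆C (there (there v∈)) }
        where
        fresh : u ∉ w ∷ h ∷ xs
        fresh (here refl)         = u∉ (here refl)
        fresh (there (here refl)) = Adj⇒≢ e refl
        fresh (there (there u∈))  = u∉ (there u∈)
      next : ∀ {ys} → Chain h ys w → ys ≡ xs → Cycle w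
      next (link _) refl with u , u≢w , u∈C , eu ← anotherNbr (⊆C (here refl)) w =
        extend eu u∈C λ { (here refl) → u≢w refl }
      next (_◅_ {x = x} {xs = xs′} ex ch′) refl
        with u , u≢x , u∈C , eu ← anotherNbr (⊆C (here refl)) x
        with u ≟ w
      ... | yes refl = closeCycle ch eu uniq ⊆C
      ... | no u≢w   = extend eu u∈C λ
        { (here refl)         → u≢w refl
        ; (there (here refl)) → u≢x refl
        ; (there (there u∈))  → offPath u∈ }
        where
        uniq″ : Unique (x ∷ w ∷ xs′)
        uniq″ = Unique-resp-↭ (swap w x ↭-refl) (AllPairs.tail uniq)
        -- An interior vertex of the path already has its two neighbours on it.
        offPath : u ∉ xs′
        offPath u∈
          with p , s , p≢s , (p∈ , ep) , (s∈ , es) ← Chain-interior ch′ uniq″ u∈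
          with atMostTwo u∈C (⊆C (there (there p∈))) (⊆C (skip s∈)) (⊆C (here refl)) ep es (Adj-sym eu) p≢s
          where
          skip : ∀ {s} → s ∈ w ∷ xs′ → s ∈ h ∷ w ∷ x ∷ xs′
          skip (here eq)  = there (here eq)
          skip (there s∈) = there (there (there s∈))
        ... | inj₁ refl = All.lookup h∉ p∈ refl
        ... | inj₂ refl with s∈
        ...   | here refl  = h≢w refl
        ...   | there s∈xs = All.lookup h∉ (there s∈xs) refl

    cycleAt : ∀ {w} → w ∈ C → Cycle w
    cycleAt {w} w∈C with h , _ , _ , (h∈C , e) , _ ← twoNbrs w∈C =
      extendToCycle n (ℕ.+-identityʳ n) (link (Adj-sym e)) ((Adj⇒≢ (Adj-sym e) ∷ []) ∷ [] ∷ [])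
        λ { (here refl) → h∈C ; (there (here refl)) → w∈C }

    -- Forcing around the cycle.

    -- The color-change rule inside the core, with `v` barred from forcing: trees may hang at `v`,
    -- so it may have white neighbours off the cycle. The predicate `F` is arbitrary so that it can
    -- later be blackness from any chosen seeds.
    Forcing : V → (V → Set) → Set
    Forcing v F = ∀ {a b} → a ∈ C → a ≢ v → F a → b ∈ C → Adj G a b →
                  (∀ {c} → c ∈ C → Adj G a c → c ≢ b → F c) → F b

    force-next : ∀ {v F a p b} → Forcing v F → a ∈ C → a ≢ v → F a → p ∈ C → Adj G a p → F p →
                 b ∈ C → Adj G a b → p ≢ b → F b
    force-next {F = F} {a} {p} {b} forcing a∈C a≢v Fa p∈C ep Fp b∈C eb p≢b =
      forcing a∈C a≢v Fa b∈C eb other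
      where
      other : ∀ {c} → c ∈ C → Adj G a c → c ≢ b → F c
      other c∈C ec c≢b with atMostTwo a∈C p∈C b∈C c∈C ep eb ec p≢b
      ... | inj₁ refl = Fp
      ... | inj₂ refl = contradiction refl c≢b

    -- With `p` black on one side of `a`, the next chain vertex is the only core neighbour of `a`
    -- that can be white. After that force `a` takes the part of `p`; only vertices before `v` ever
    -- force.
    force-along : ∀ {v F a p xs} → Forcing v F → Chain a xs v → Unique (a ∷ v ∷ xs) →
                  (∀ {u} → u ∈ a ∷ v ∷ xs → u ∈ C) → p ∈ C → p ∉ xs → Adj G a p → F p → F a →
                  ∀ {u} → u ∈ v ∷ xs → F u
    force-along {v} {p = p} forcing (link e) ((a≢v ∷ _) ∷ _) ⊆C p∈C p∉ ep Fp Fa (here refl)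
      with p ≟ v
    -- The black neighbour may be the target `v` itself, and then no force takes place.
    ... | yes refl = Fp
    ... | no p≢v   =
      force-next forcing (⊆C (here refl)) a≢v Fa p∈C ep Fp (⊆C (there (here refl))) e p≢v
    force-along {v} {F} {a} forcing (_◅_ {x = x} {xs} e ch)
                ((a≢v ∷ a≢x ∷ a∉) ∷ (v≢x ∷ v∉) ∷ x∉ ∷ uniq) ⊆C p∈C p∉ ep Fp Fa = λ where
        (here refl)         → onward (here refl)
        (there (here refl)) → Fx
        (there (there u∈))  → onward (there u∈)
      where
      Fx : F x
      Fx = force-next forcing (⊆C (here refl)) a≢v Fa p∈C ep Fp (⊆C (there (there (here refl)))) e
             (λ { refl → p∉ (here refl) })
      onward : ∀ {u} → u ∈ v ∷ xs → F u
      onward = force-along forcing ch (((v≢x ∘ ≡.sym) ∷ x∉) ∷ v∉ ∷ uniq)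
        (λ { (here refl)         → ⊆C (there (there (here refl)))
           ; (there (here refl)) → ⊆C (there (here refl))
           ; (there (there u∈))  → ⊆C (there (there (there u∈))) })
        (⊆C (here refl)) (All.All¬⇒¬Any a∉) (Adj-sym e) Fa Fx

    -- Both arcs of the cycle between w and v are traversed away from w, each until it meets v.
    force-cycle : ∀ {w v} → w ∈ C → v ∈ C → w ≢ v → ∃ λ w′ → w′ ∈ C ×
                  (∀ {F} → Forcing v F → F w → F w′ → ∀ {u} → u ∈ C → F u)
    force-cycle {w} {v} w∈C v∈C w≢v with cycleAt w∈C
    ... | record { chain = chain ; simple = simple ; rest⊆C = rest⊆C ; covers = covers }
      with covers v∈C
    ... | here refl = contradiction refl w≢v
    ... | there v∈ with ys , zs , refl ← ∈-∃++ v∈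
      with there-way , return ← Chain-split ys chain =
        spread (Chain-reverse return) zs⇒ ⇒zs uniq-zs
      where
      uniq∷ : Unique (v ∷ ys ++ zs)
      uniq∷ = Unique-resp-↭ (shift v ys zs) (AllPairs.tail simple)
      v∉ : v ∉ ys ++ zs
      v∉ = Unique[x∷xs]⇒x∉xs uniq∷
      w∉ : w ∉ ys ++ v ∷ zs
      w∉ = Unique[x∷xs]⇒x∉xs simple
      uniq : Unique (ys ++ zs)
      uniq = AllPairs.tail uniq∷
      zs⇒ : ∀ {u} → u ∈ reverse zs → u ∈ zs
      zs⇒ = ∈-resp-↭ (↭-reverse zs)
      ⇒zs : ∀ {u} → u ∈ zs → u ∈ reverse zs
      ⇒zs = ∈-resp-↭ (↭-sym (↭-reverse zs))
      ys⊆C : ∀ {u} → u ∈ ys → u ∈ C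
      ys⊆C = rest⊆C ∘ ∈-++⁺ˡ
      uniq-ys : Unique ys
      uniq-ys = Unique-++ˡ uniq
      uniq-zs : Unique (reverse zs)
      uniq-zs = Unique-resp-↭ (↭-sym (↭-reverse zs)) (Unique-++ʳ ys uniq)
      ends : ∀ {xs} → (∀ {u} → u ∈ xs → u ∈ C) → ∀ {u} → u ∈ w ∷ v ∷ xs → u ∈ C
      ends ⊆C (here refl)         = w∈C
      ends ⊆C (there (here refl)) = v∈C
      ends ⊆C (there (there u∈))  = ⊆C u∈
      finish : ∀ {F : V → Set} {xs} → (∀ {u} → u ∈ zs → u ∈ xs) → F w →
               (∀ {u} → u ∈ v ∷ xs → F u) → (∀ {u} → u ∈ v ∷ ys → F u) → ∀ {u} → u ∈ C → F u
      finish zs⊆ Fw Fzs Fys u∈C with covers u∈C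
      ... | here refl = Fw
      ... | there u∈ with ∈-++⁻ ys u∈
      ...   | inj₁ u∈ys         = Fys (there u∈ys)
      ...   | inj₂ (here refl)  = Fys (here refl)
      ...   | inj₂ (there u∈zs) = Fzs (there (zs⊆ u∈zs))
      spread : ∀ {xs} → Chain w xs v → (∀ {u} → u ∈ xs → u ∈ zs) → (∀ {u} → u ∈ zs → u ∈ xs) →
               Unique xs → ∃ λ w′ → w′ ∈ C ×
               (∀ {F} → Forcing v F → F w → F w′ → ∀ {u} → u ∈ C → F u)
      along-ys : ∀ {F p} → Forcing v F → p ∈ C → p ∉ ys → Adj G w p → F p → F w →
                 ∀ {u} → u ∈ v ∷ ys → F u
      along-ys forcing = force-along forcing there-way
        ((w≢v ∷ All.¬Any⇒All¬ _ (w∉ ∘ ∈-++⁺ˡ)) ∷ All.¬Any⇒All¬ _ (v∉ ∘ ∈-++⁺ˡ) ∷ uniq-ys)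
        (ends ys⊆C)
      -- The second arc has no interior: `v` is the neighbour of `w` on that side and is itself
      -- taken as `w′`.
      spread (link e) _ ⇒xs _ = v , v∈C , λ {F} forcing Fw Fv →
        finish {F} ⇒xs Fw (λ { (here refl) → Fv })
               (along-ys {F} forcing v∈C (v∉ ∘ ∈-++⁺ˡ) e Fv Fw)
      -- The neighbour `x` of `w` on the second arc is taken as `w′`. It is the black neighbour that
      -- starts the first arc at `w`, while `w` is the one that starts the rest of the second arc at
      -- `x`.
      spread {x ∷ xs} (e ◅ ch) xs⇒ ⇒xs (x∉ ∷ uniq-xs) = x , xs⊆C (here refl) , λ {F} forcing Fw Fx →
        finish {F} ⇒xs Fw
          (λ { (here refl)         → onward forcing Fw Fx (here refl)
             ; (there (here refl)) → Fx
             ; (there (there u∈))  → onward forcing Fw Fx (there u∈) })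
          (along-ys {F} forcing (xs⊆C (here refl)) x∉ys e Fx Fw)
        where
        xs⊆C : ∀ {u} → u ∈ x ∷ xs → u ∈ C
        xs⊆C u∈ = rest⊆C (∈-++⁺ʳ ys (there (xs⇒ u∈)))
        x∉ys : x ∉ ys
        x∉ys x∈ys = Unique-++⇒≢ uniq x∈ys (xs⇒ (here refl)) refl
        v∉xs : v ∉ x ∷ xs
        v∉xs v∈xs = v∉ (∈-++⁺ʳ ys (xs⇒ v∈xs))
        w∉xs : w ∉ x ∷ xs
        w∉xs w∈xs = w∉ (∈-++⁺ʳ ys (there (xs⇒ w∈xs)))
        onward : ∀ {F} → Forcing v F → F w → F x → ∀ {u} → u ∈ v ∷ xs → F u
        onward {F} forcing Fw Fx = force-along {F = F} forcing ch
          (((λ { refl → v∉xs (here refl) }) ∷ x∉) ∷ All.¬Any⇒All¬ _ (v∉xs ∘ there) ∷ uniq-xs)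
          (λ { (here refl)         → xs⊆C (here refl)
             ; (there (here refl)) → v∈C
             ; (there (there u∈))  → xs⊆C (there u∈) })
          w∈C (w∉xs ∘ there) (Adj-sym e) Fw Fx

  -- Forcing in induced subgraphs when a pendant vertex is attached.

  open import Data.List.Membership.DecPropositional (_≟_ {n}) using (_∈?_)

  data Forced (A S : List V) : V → Set where
    start : ∀ {v} → v ∈ S → Forced A S v
    push  : ∀ {x y} → x ∈ A → Adj G x y → y ∈ A → Forced A S x →
            (∀ {w} → w ∈ A → Adj G x w → w ≢ y → Forced A S w) → Forced A S y

  Forced-trans : ∀ {A S S′ v} → (∀ {u} → u ∈ S → Forced A S′ u) → Forced A S v → Forced A S′ v
  Forced-trans S⇒ (start v∈)             = S⇒ v∈
  Forced-trans S⇒ (push x∈ e y∈ Fx rest) =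
    push x∈ e y∈ (Forced-trans S⇒ Fx) λ w∈ ew w≢ → Forced-trans S⇒ (rest w∈ ew w≢)

  -- The only new vertex that can obstruct an old force is `y`, and it is black beforehand.
  Forced-∷ : ∀ {A S S′ y v} → (∀ {u} → u ∈ S → Forced (y ∷ A) S′ u) → Forced (y ∷ A) S′ y →
             Forced A S v → Forced (y ∷ A) S′ v
  Forced-∷ S⇒ Fy (start v∈)             = S⇒ v∈
  Forced-∷ S⇒ Fy (push x∈ e v∈ Fx rest) = push (there x∈) e (there v∈) (Forced-∷ S⇒ Fy Fx) λ where
    (here refl) _  _  → Fy
    (there w∈)  ew w≢ → Forced-∷ S⇒ Fy (rest w∈ ew w≢)

  module _ {A : List V} {y : V} (y∉A : y ∉ A) (pendant : IsPendant A y) where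

    private
      x = proj₁ pendant
      x∈A = proj₁ (proj₂ pendant)
      e = proj₁ (proj₂ (proj₂ pendant))
      only = proj₂ (proj₂ (proj₂ pendant))

    pendant-∷ : IsPendant (y ∷ A) y
    pendant-∷ = x , there x∈A , e , λ where
      (here refl) loop → contradiction refl (Adj⇒≢ loop)
      (there u∈)  eu   → only u∈ eu

    -- Attaching `y` changes the neighbourhood of no old vertex but `x`.
    IsPendant-∷ : ∀ {u} → u ∈ A → u ≢ x → IsPendant A u → IsPendant (y ∷ A) u
    IsPendant-∷ u∈A u≢x (z , z∈ , ez , only-z) = z , there z∈ , ez , λ where
      (here refl) eu → contradiction (only u∈A (Adj-sym eu)) u≢x
      (there t∈)  et → only-z t∈ et

    pendant-pushes : ∀ {S} → Forced (y ∷ A) S y → Forced (y ∷ A) S x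
    pendant-pushes Fy = push (here refl) e (there x∈A) Fy λ where
      (here refl) loop _   → contradiction refl (Adj⇒≢ loop)
      (there w∈)  ew   w≢x → contradiction (only w∈ ew) w≢x

    -- A pendant x outside S is black only after its neighbour z, so it never forces in A
    -- and is free to force y at the end.
    Forced-lengthen : ∀ {S S′} → IsPendant A x → x ∉ S → (∀ {u} → u ∈ S → u ∈ S′) →
                      ∀ {v} → Forced A S v → Forced (y ∷ A) S′ v
    Forced-lengthen {S} {S′} (z , _ , _ , only-z) x∉S S⊆S′ = go
      where
      go : ∀ {v} → Forced A S v → Forced (y ∷ A) S′ v
      go (start v∈) = start (S⊆S′ v∈)
      go (push {s} s∈ es v∈ Fs rest) with s ≟ x
      ... | no s≢x = push (there s∈) es (there v∈) (go Fs) λ where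
        (here refl) ey _  → contradiction (only s∈ (Adj-sym ey)) s≢x
        (there w∈)  ew w≢ → go (rest w∈ ew w≢)
      go (push s∈ es v∈ (start s∈S) rest) | yes refl = contradiction s∈S x∉S
      go (push s∈ es v∈ (push t∈ et _ Ft _) rest) | yes refl
        with refl ← ≡.trans (only-z t∈ (Adj-sym et)) (≡.sym (only-z v∈ es)) = go Ft

  -- Certificates that compare seeds with leaves.

  replace : V → V → V → V
  replace x y u with u ≟ x
  ... | yes _ = y
  ... | no _  = u

  replace-≡ : ∀ x y → replace x y x ≡ y
  replace-≡ x y with x ≟ x
  ... | yes _  = refl
  ... | no x≢x = contradiction refl x≢x

  replace-≢ : ∀ {x u} y → u ≢ x → replace x y u ≡ u
  replace-≢ {x} {u} y u≢x with u ≟ x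
  ... | yes u≡x = contradiction u≡x u≢x
  ... | no _    = refl

  replace-injective : ∀ {x y u v} → u ≢ y → v ≢ y → replace x y u ≡ replace x y v → u ≡ v
  replace-injective {x} {y} {u} {v} u≢y v≢y eq with u ≟ x | v ≟ x
  ... | yes refl | yes refl = refl
  ... | yes _    | no _     = contradiction (≡.sym eq) v≢y
  ... | no _     | yes _    = contradiction eq u≢y
  ... | no _     | no _     = eq

  Unique-replace : ∀ {x y xs} → Unique xs → y ∉ xs → Unique (map (replace x y) xs)
  Unique-replace []           y∉ = []
  Unique-replace (u∉ ∷ uniq)  y∉ =
    All.map⁺ (All.tabulate λ v∈ eq → All.lookup u∉ v∈
      (replace-injective (λ { refl → y∉ (here refl) }) (λ { refl → y∉ (there v∈) }) eq))
    ∷ Unique-replace uniq (y∉ ∘ there)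

  ∈-replace⁻ : ∀ {x y u} xs → u ∈ map (replace x y) xs → u ≡ y ⊎ u ∈ xs × u ≢ x
  ∈-replace⁻ {x} {y} xs u∈ with t , t∈ , refl ← ∈-map⁻ (replace x y) u∈ with t ≟ x
  ... | yes _  = inj₁ refl
  ... | no t≢x = inj₂ (t∈ , t≢x)

  ∈-replace⁺ : ∀ {x y u xs} → u ∈ xs → u ≢ x → u ∈ map (replace x y) xs
  ∈-replace⁺ {x} {y} {xs = xs} u∈ u≢x = subst (_∈ map (replace x y) xs) (replace-≢ y u≢x) (∈-map⁺ (replace x y) u∈)

  replaced-∈ : ∀ {x y xs} → x ∈ xs → y ∈ map (replace x y) xs
  replaced-∈ {x} {y} {xs} x∈ = subst (_∈ map (replace x y) xs) (replace-≡ x y) (∈-map⁺ (replace x y) x∈)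

  -- The vertices of `base` are black free of charge, and `c` is the number of leaves held in
  -- reserve over the seeds. It is used with the core as base and `c = 1`, and with empty base and
  -- `c = 0`. Leaves avoid the base so that moving a leaf outwards never disturbs it.
  record Certificate (base : List V) (c : ℕ) (A : List V) : Set where
    field
      seeds leaves : List V
      base⊆A       : ∀ {u} → u ∈ base → u ∈ A
      leaves⊆A     : ∀ {u} → u ∈ leaves → u ∈ A
      leaves∩base  : ∀ {u} → u ∈ leaves → u ∉ base
      distinct     : Unique leaves
      pendants     : ∀ {u} → u ∈ leaves → IsPendant A u
      forces       : ∀ {u} → u ∈ A → Forced A (base ++ seeds) u
      bound        : length seeds + c ≤ length leaves

  -- If `y` hangs at a recorded leaf `x`, it replaces `x` among leaves and seeds and both counts
  -- stay. Otherwise `y` is added to both lists, and the reserve is unchanged.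
  Certificate-∷ : ∀ {base c A y} → y ∉ A → IsPendant A y → Certificate base c A →
                  Certificate base c (y ∷ A)
  Certificate-∷ {base} {c} {A} {y} y∉A pendant@(x , x∈A , e , only) cert with x ∈? Certificate.leaves cert
  ... | no x∉leaves = record
    { seeds       = y ∷ seeds
    ; leaves      = y ∷ leaves
    ; base⊆A      = there ∘ base⊆A
    ; leaves⊆A    = λ { (here eq) → here eq ; (there u∈) → there (leaves⊆A u∈) }
    ; leaves∩base = λ { (here refl) → y∉A ∘ base⊆A ; (there u∈) → leaves∩base u∈ }
    ; distinct    = All.¬Any⇒All¬ _ (y∉A ∘ leaves⊆A) ∷ distinct
    ; pendants    = λ where
        (here refl) → pendant-∷ y∉A pendant
        (there u∈)  → IsPendant-∷ y∉A pendant (leaves⊆A u∈) (λ { refl → x∉leaves u∈ }) (pendants u∈)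
    ; forces      = λ where
        (here refl) → Fy
        (there u∈)  → Forced-∷ weaken Fy (forces u∈)
    ; bound       = s≤s bound
    }
    where
    open Certificate cert
    Fy : Forced (y ∷ A) (base ++ y ∷ seeds) y
    Fy = start (∈-++⁺ʳ base (here refl))
    weaken : ∀ {u} → u ∈ base ++ seeds → Forced (y ∷ A) (base ++ y ∷ seeds) u
    weaken u∈ with ∈-++⁻ base u∈
    ... | inj₁ u∈base  = start (∈-++⁺ˡ u∈base)
    ... | inj₂ u∈seeds = start (∈-++⁺ʳ base (there u∈seeds))
  ... | yes x∈leaves = record
    { seeds       = map (replace x y) seeds
    ; leaves      = map (replace x y) leaves
    ; base⊆A      = there ∘ base⊆A
    ; leaves⊆A    = λ u∈ → case (∈-replace⁻ leaves u∈) of λ where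
        (inj₁ refl)         → here refl
        (inj₂ (u∈ , _))     → there (leaves⊆A u∈)
    ; leaves∩base = λ u∈ → case (∈-replace⁻ leaves u∈) of λ where
        (inj₁ refl)         → y∉A ∘ base⊆A
        (inj₂ (u∈ , _))     → leaves∩base u∈
    ; distinct    = Unique-replace distinct (y∉A ∘ leaves⊆A)
    ; pendants    = λ u∈ → case (∈-replace⁻ leaves u∈) of λ where
        (inj₁ refl)         → pendant-∷ y∉A pendant
        (inj₂ (u∈ , u≢x))   → IsPendant-∷ y∉A pendant (leaves⊆A u∈) u≢x (pendants u∈)
    ; forces      = forces′
    ; bound       = subst₂ (λ s l → s + c ≤ l) (≡.sym (length-map (replace x y) seeds))
                      (≡.sym (length-map (replace x y) leaves)) bound
    }
    where
    open Certificate cert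
    T T′ : List V
    T = base ++ seeds
    T′ = base ++ map (replace x y) seeds
    kept : ∀ {u} → u ∈ T → u ≢ x → u ∈ T′
    kept u∈ u≢x with ∈-++⁻ base u∈
    ... | inj₁ u∈base  = ∈-++⁺ˡ u∈base
    ... | inj₂ u∈seeds = ∈-++⁺ʳ base (∈-replace⁺ u∈seeds u≢x)
    moved : x ∈ T → y ∈ T′
    moved x∈ with ∈-++⁻ base x∈
    ... | inj₁ x∈base  = contradiction x∈base (leaves∩base x∈leaves)
    ... | inj₂ x∈seeds = ∈-++⁺ʳ base (replaced-∈ x∈seeds)
    forces′ : ∀ {u} → u ∈ y ∷ A → Forced (y ∷ A) T′ u
    forces′ with x ∈? T
    -- The seed has moved from `x` to `y`; `y` forces `x` first, and the old forces follow.
    ... | yes x∈T = λ where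
        (here refl) → Fy
        (there u∈)  → Forced-∷ init Fy (forces u∈)
      where
      Fy : Forced (y ∷ A) T′ y
      Fy = start (moved x∈T)
      init : ∀ {u} → u ∈ T → Forced (y ∷ A) T′ u
      init {u} u∈ with u ≟ x
      ... | yes refl = pendant-pushes y∉A pendant Fy
      ... | no u≢x   = start (kept u∈ u≢x)
    -- The old forces run without any force by `x`, which then forces `y` last.
    ... | no x∉T = λ where
        (here refl) → push (there x∈A) (Adj-sym e) (here refl) (old x∈A) λ where
          (here refl) _ w≢y → contradiction refl w≢y
          (there w∈)  _ _   → old w∈
        (there u∈)  → old u∈
      where
      old : ∀ {u} → u ∈ A → Forced (y ∷ A) T′ u
      old u∈ = Forced-lengthen y∉A pendant (pendants x∈leaves) x∉T
                 (λ t∈ → kept t∈ (λ { refl → x∉T t∈ })) (forces u∈)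

  -- How the trees are attached to the cycle.

  module _ {C : List V} (isCore : IsCore C) where

    -- Says that within `B` trees hang at no cycle vertex other than `v`.
    ClosedOff : V → List V → Set
    ClosedOff v B = ∀ {a u} → a ∈ C → a ≢ v → u ∈ B → Adj G a u → u ∈ C

    -- In `oneRoot` the core still has to be blackened, at a cost of two seeds: the reserve of one
    -- pays for the first, and a core vertex added to the leaves pays for the second. In `twoRoots`
    -- the reserve has already been spent on the core.
    data Shape (B : List V) : Set where
      bare     : (∀ {u} → u ∈ B → u ∈ C) → Shape B
      oneRoot  : ∀ {v} → v ∈ C → ClosedOff v B → Certificate C 1 B → Shape B
      twoRoots : Certificate [] 0 B → Shape B

    Grown-⊇ : ∀ {B} → Grown C B → ∀ {u} → u ∈ C → u ∈ B
    Grown-⊇ core          u∈ = u∈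
    Grown-⊇ (grow _ _ gr) u∈ = there (Grown-⊇ gr u∈)

    -- A neighbour off the core is black already, so a force within the core is also a force in `B`.
    closed⇒forcing : ∀ {v B S} → (∀ {u} → u ∈ C → u ∈ B) →
                     (∀ {a u} → a ∈ C → a ≢ v → u ∈ B → Adj G a u → u ∈ C ⊎ Forced B S u) →
                     Forcing isCore v (Forced B S)
    closed⇒forcing C⊆B closed a∈ a≢v Fa b∈ e rest = push (C⊆B a∈) e (C⊆B b∈) Fa λ w∈ ew w≢b →
      case closed a∈ a≢v w∈ ew of λ where
        (inj₁ w∈C) → rest w∈C ew w≢b
        (inj₂ Fw)  → Fw

    ClosedOff-∷ : ∀ {v B y} → (∀ {u} → u ∈ C → u ∈ B) → (pendant : IsPendant B y) →
                  (proj₁ pendant ∈ C → proj₁ pendant ≡ v) → ClosedOff v B → ClosedOff v (y ∷ B)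
    ClosedOff-∷ C⊆B (x , _ , _ , only) x∈C⇒ closed a∈ a≢v (there u∈) e = closed a∈ a≢v u∈ e
    ClosedOff-∷ C⊆B (x , _ , _ , only) x∈C⇒ closed a∈ a≢v (here refl) e
      with refl ← only (C⊆B a∈) (Adj-sym e) = contradiction (x∈C⇒ a∈) a≢v

    -- The black core forces the first pendant vertex, so this leaf needs no seed; here the reserve
    -- of one arises.
    firstRoot : ∀ {B y} → (∀ {u} → u ∈ C → u ∈ B) → (∀ {u} → u ∈ B → u ∈ C) → y ∉ B →
                IsPendant B y → Certificate C 1 (y ∷ B)
    firstRoot {B} {y} C⊆B B⊆C y∉B pendant@(x , x∈B , e , only) = record
      { seeds       = []
      ; leaves      = y ∷ []
      ; base⊆A      = there ∘ C⊆B
      ; leaves⊆A    = λ { (here eq) → here eq }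
      ; leaves∩base = λ { (here refl) → y∉B ∘ C⊆B }
      ; distinct    = [] ∷ []
      ; pendants    = λ { (here refl) → pendant-∷ y∉B pendant }
      ; forces      = λ where
          (here refl) → push (there x∈B) (Adj-sym e) (here refl) (old x∈B) λ where
            (here refl) _ w≢y → contradiction refl w≢y
            (there w∈)  _ _   → old w∈
          (there u∈)  → old u∈
      ; bound       = s≤s z≤n
      }
      where
      old : ∀ {u} → u ∈ B → Forced (y ∷ B) (C ++ []) u
      old u∈ = start (∈-++⁺ˡ (B⊆C u∈))

    -- The seed `y` forces its neighbour `x` on the cycle; `x` and one more cycle vertex then
    -- blacken the core without a force by `v`. From there the forces of the old certificate run.
    secondRoot : ∀ {v B y} → (∀ {u} → u ∈ C → u ∈ B) → y ∉ B → (pendant : IsPendant B y) →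
                 proj₁ pendant ∈ C → proj₁ pendant ≢ v → v ∈ C → ClosedOff v B →
                 Certificate C 1 B → Certificate [] 0 (y ∷ B)
    secondRoot {v} {B} {y} C⊆B y∉B pendant@(x , x∈B , e , only) x∈C x≢v v∈C closed cert
      with w , w∈C , spread ← force-cycle isCore x∈C v∈C x≢v = record
      -- The new leaf `y` pays for the seed `y`, the reserve of one for the seed `w`.
      { seeds       = y ∷ w ∷ seeds
      ; leaves      = y ∷ leaves
      ; base⊆A      = λ ()
      ; leaves⊆A    = λ { (here eq) → here eq ; (there u∈) → there (leaves⊆A u∈) }
      ; leaves∩base = λ _ ()
      ; distinct    = All.¬Any⇒All¬ _ (y∉B ∘ leaves⊆A) ∷ distinct
      ; pendants    = λ where
          (here refl) → pendant-∷ y∉B pendant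
          (there u∈)  → IsPendant-∷ y∉B pendant (leaves⊆A u∈)
                          (λ { refl → leaves∩base u∈ x∈C }) (pendants u∈)
      ; forces      = λ where
          (here refl) → Fy w
          (there u∈)  → Forced-∷ (old w (spread {F w} (forcing w) (pendant-pushes y∉B pendant (Fy w))
                                           (start (there (here refl)))))
                                 (Fy w) (forces u∈)
      ; bound       = s≤s (ℕ.≤-trans (ℕ.≤-reflexive arith) bound)
      }
      where
      open Certificate cert
      -- The predicate depends on the seed `w`, which is possible because `force-cycle` fixes that
      -- vertex before it quantifies over predicates.
      F : V → V → Set
      F w = Forced (y ∷ B) (y ∷ w ∷ seeds)
      Fy : ∀ w → F w y
      Fy w = start (here refl)
      forcing : ∀ w → Forcing isCore v (F w)
      forcing w = closed⇒forcing (there ∘ C⊆B) λ where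
        a∈ a≢v (here refl) _  → inj₂ (Fy w)
        a∈ a≢v (there u∈)  eu → inj₁ (closed a∈ a≢v u∈ eu)
      old : ∀ w → (∀ {u} → u ∈ C → F w u) → ∀ {u} → u ∈ C ++ seeds → F w u
      old w FC u∈ with ∈-++⁻ C u∈
      ... | inj₁ u∈C     = FC u∈C
      ... | inj₂ u∈seeds = start (there (there u∈seeds))
      arith : suc (length seeds) + 0 ≡ length seeds + 1
      arith = ≡.trans (ℕ.+-identityʳ _) (ℕ.+-comm 1 _)

    -- Once there is a root, only attaching to a core vertex other than `v` creates a second one;
    -- attaching to `v` or to a tree vertex leaves `v` the sole root.
    shape : ∀ {B} → Grown C B → Shape B
    shape core = bare id
    shape (grow y∉ pendant@(x , x∈ , e , only) gr) with shape gr
    ... | bare B⊆C =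
      oneRoot (B⊆C x∈)
              (ClosedOff-∷ (Grown-⊇ gr) pendant (λ _ → refl) (λ _ _ u∈ _ → B⊆C u∈))
              (firstRoot (Grown-⊇ gr) B⊆C y∉ pendant)
    ... | twoRoots cert = twoRoots (Certificate-∷ y∉ pendant cert)
    ... | oneRoot {v} v∈ closed cert with x ≟ v | x ∈? C
    ...   | no x≢v   | yes x∈C =
      twoRoots (secondRoot (Grown-⊇ gr) y∉ pendant x∈C x≢v v∈ closed cert)
    ...   | yes x≡v  | _       =
      oneRoot v∈ (ClosedOff-∷ (Grown-⊇ gr) pendant (λ _ → x≡v) closed) (Certificate-∷ y∉ pendant cert)
    ...   | no _     | no x∉C  =
      oneRoot v∈ (ClosedOff-∷ (Grown-⊇ gr) pendant (λ x∈C → contradiction x∈C x∉C) closed)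
              (Certificate-∷ y∉ pendant cert)

  -- Geodesics and general position.

  _++ʷ_ : ∀ {u v w i j} → Walk G u v i → Walk G v w j → Walk G u w (i + j)
  [ _ ]    ++ʷ q = q
  (e ∷ʷ p) ++ʷ q = e ∷ʷ (p ++ʷ q)

  reverseʷ : ∀ {u v i} → Walk G u v i → Walk G v u i
  reverseʷ [ v ]                = [ v ]
  reverseʷ (_∷ʷ_ {k = k} e p) =
    subst (Walk G _ _) (ℕ.+-comm k 1) (reverseʷ p ++ʷ (Adj-sym e ∷ʷ [ _ ]))

  splitʷ : ∀ {x u v k} {p : Walk G u v k} → OnWalk G x p →
           ∃₂ λ i j → Walk G u x i × Walk G x v j × i + j ≡ k
  splitʷ here-end       = 0 , 0 , [ _ ] , [ _ ] , refl
  splitʷ (here e p)     = 0 , _ , [ _ ] , e ∷ʷ p , refl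
  splitʷ (there e p on) with i , j , q , r , eq ← splitʷ on = suc i , j , e ∷ʷ q , r , cong suc eq

  -- Joining the two walks at `m` would connect `u` to `v` in fewer than `k` steps.
  no-shortcut : ∀ {u v m k i j i′ j′} {p : Walk G u v k} → IsGeodesic G p → i + j ≡ k →
                Walk G m u i′ → i′ < i → Walk G m v j′ → j′ < j → ⊥
  no-shortcut geo refl q i′<i r j′<j =
    ℕ.<⇒≱ (ℕ.+-mono-< i′<i j′<j) (geo _ (reverseʷ q ++ʷ r))

  -- Encodes degree at most one: adjacency of `x` and `z` is not part of it.
  IsLeaf : V → Set
  IsLeaf x = ∃ λ z → ∀ {u} → Adj G x u → u ≡ z

  -- A leaf inside a walk is entered and left through the same vertex `z`; cutting the leaf out
  -- makes both halves one step shorter.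
  leaf-endpoint : ∀ {x u v k} {p : Walk G u v k} → IsLeaf x → IsGeodesic G p → OnWalk G x p →
                  x ≡ u ⊎ x ≡ v
  leaf-endpoint {p = p} (z , only) geo on with splitʷ on
  ... | _ , _ , q , r , eq with reverseʷ q | r
  ...   | [ _ ]     | _        = inj₁ refl
  ...   | _         | [ _ ]    = inj₂ refl
  ...   | e ∷ʷ q′   | e′ ∷ʷ r′ with refl ← only e | refl ← only e′ =
    ⊥-elim (no-shortcut {p = p} geo eq q′ (ℕ.n<1+n _) r′ (ℕ.n<1+n _))

  -- Only `v` leads out of `C`, so the walk visits `v`, and it does so after at least one step
  -- because `x ≢ v`.
  exit-through : ∀ {C : List V} {v} → (∀ {a u} → a ∈ C → a ≢ v → Adj G a u → u ∈ C) →
                 ∀ {x t k} → x ∈ C → x ≢ v → t ∉ C → Walk G x t k →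
                 ∃ λ k′ → k′ < k × Walk G v t k′
  exit-through closed x∈ x≢v t∉ [ _ ] = contradiction x∈ t∉
  exit-through {v = v} closed x∈ x≢v t∉ (_∷ʷ_ {w = w} e p) with w ≟ v
  ... | yes refl = _ , ℕ.n<1+n _ , p
  ... | no w≢v with k′ , k′<k , q ← exit-through closed (closed x∈ x≢v e) w≢v t∉ p =
    k′ , ℕ.m<n⇒m<1+n k′<k , q

  -- Among three distinct vertices one avoids both e and f.
  general-position : (R : List V) →
    (∀ {u v k} (p : Walk G u v k) → IsGeodesic G p →
      ∃₂ λ e f → ∀ {r} → r ∈ R → OnWalk G r p → r ≡ e ⊎ r ≡ f) →
    IsGeneralPosition G (fromList R)
  general-position R twoOnly x y z x∈ y∈ z∈ x≢y y≢z x≢z (u , v , k , p , geo , onx , ony , onz)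
    with e , f , only ← twoOnly p geo
    with only (∈-fromList⁻ R x∈) onx | only (∈-fromList⁻ R y∈) ony | only (∈-fromList⁻ R z∈) onz
  ... | inj₁ refl | inj₁ refl | _         = x≢y refl
  ... | inj₁ refl | inj₂ refl | inj₁ refl = x≢z refl
  ... | inj₁ refl | inj₂ refl | inj₂ refl = y≢z refl
  ... | inj₂ refl | inj₂ refl | _         = x≢y refl
  ... | inj₂ refl | inj₁ refl | inj₁ refl = y≢z refl
  ... | inj₂ refl | inj₁ refl | inj₂ refl = x≢z refl

  leaves-general : ∀ {R} → (∀ {x} → x ∈ R → IsLeaf x) → IsGeneralPosition G (fromList R)
  leaves-general {R} leaf = general-position R λ {u} {v} p geo →
    u , v , λ r∈ on → leaf-endpoint {p = p} (leaf r∈) geo on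

  -- A geodesic meets `R` only at its ends. If both ends are in `R`, it cannot contain `w`: both
  -- halves starting at `w` leave the core through `v`, and joining them at `v` is shorter. If one
  -- end is not in `R`, at most the other end and `w` are met.
  leaves-and-one-general : ∀ {C R v w} → (∀ {a u} → a ∈ C → a ≢ v → Adj G a u → u ∈ C) →
    w ∈ C → w ≢ v → (∀ {x} → x ∈ R → x ∉ C) → (∀ {x} → x ∈ R → IsLeaf x) →
    IsGeneralPosition G (fromList (w ∷ R))
  leaves-and-one-general {R = R} {v} {w} closed w∈ w≢v R∩C leaf = general-position (w ∷ R) pair
    where
    pair : ∀ {s t k} (p : Walk G s t k) → IsGeodesic G p →
           ∃₂ λ e f → ∀ {r} → r ∈ w ∷ R → OnWalk G r p → r ≡ e ⊎ r ≡ f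
    pair {s} {t} p geo with s ∈? R | t ∈? R
    ... | no s∉R | _ = w , t , λ where
      (here refl) _  → inj₁ refl
      (there r∈)  on → case leaf-endpoint {p = p} (leaf r∈) geo on of λ where
        (inj₁ refl) → contradiction r∈ s∉R
        (inj₂ r≡t)  → inj₂ r≡t
    ... | yes _ | no t∉R = w , s , λ where
      (here refl) _  → inj₁ refl
      (there r∈)  on → case leaf-endpoint {p = p} (leaf r∈) geo on of λ where
        (inj₁ r≡s)  → inj₂ r≡s
        (inj₂ refl) → contradiction r∈ t∉R
    ... | yes s∈R | yes t∈R = s , t , λ where
      (there r∈)  on → leaf-endpoint {p = p} (leaf r∈) geo on
      (here refl) on →
        let _ , _ , q , r , eq = splitʷ on
            _ , i< , q′ = exit-through closed w∈ w≢v (R∩C s∈R) (reverseʷ q)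
            _ , j< , r′ = exit-through closed w∈ w≢v (R∩C t∈R) r
        in ⊥-elim (no-shortcut {p = p} geo eq q′ i< r′ j<)

  -- From induced subgraphs to the two invariants of the graph.

  Forced⇒Black : ∀ {A S} → (∀ u → u ∈ A) → ∀ {u} → Forced A S u → Black G (fromList S) u
  Forced⇒Black all (start u∈)            = initial (∈-fromList⁺ u∈)
  Forced⇒Black all (push x∈ e y∈ Fx rest) =
    force (Forced⇒Black all Fx) e λ w ew w≢ → Forced⇒Black all (rest (all w) ew w≢)

  Walk⇒Path : ∀ {u v k} → Walk G u v k → Path (allFin n) u v
  Walk⇒Path [ _ ]    = stop
  Walk⇒Path (e ∷ʷ p) = step e (∈-allFin _) (Walk⇒Path p)

  -- The length of `S` bounds the size of its set from above; for the length of `R` to bound a size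
  -- from below, `R` has to be free of repetitions.
  Dominates : Set
  Dominates = ∃₂ λ S R → IsZeroForcingSet G (fromList S) × IsGeneralPosition G (fromList R) ×
                         Unique R × length S ≤ length R

  dominates : ∀ {C B} → (∀ u → u ∈ B) → (isCore : IsCore C) → Grown C B → Dominates
  dominates {C} {B} all isCore gr with shape isCore gr
  ... | bare B⊆C
    with w , w∈C ← IsCore.nonempty isCore
    -- On a bare cycle `v` marks where the two arcs from `w` meet and also completes the two-element
    -- general position set.
    with v , _ , _ , (v∈C , e) , _ ← IsCore.twoNbrs isCore w∈C
    with w′ , _ , spread ← force-cycle isCore w∈C v∈C (Adj⇒≢ e)
    = w ∷ w′ ∷ [] , w ∷ v ∷ []
    , (λ u → Forced⇒Black all (spread {Forced B (w ∷ w′ ∷ [])}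
        (closed⇒forcing isCore (Grown-⊇ isCore gr) (λ _ _ u∈ _ → inj₁ (B⊆C u∈)))
        (start (here refl)) (start (there (here refl))) (B⊆C (all u))))
    , general-position (w ∷ v ∷ []) (λ _ _ → w , v , λ where
        (here r≡w)         _ → inj₁ r≡w
        (there (here r≡v)) _ → inj₂ r≡v)
    , (Adj⇒≢ e ∷ []) ∷ [] ∷ [] , ℕ.≤-refl
  ... | twoRoots cert = seeds , leaves , (λ u → Forced⇒Black all (forces (all u)))
      , leaves-general (λ x∈ → let z , _ , _ , only = pendants x∈ in z , λ {u} → only (all u))
      , distinct , ℕ.≤-trans (ℕ.m≤m+n (length seeds) 0) bound
    where open Certificate cert
  ... | oneRoot {v} v∈C closed cert
    with w , _ , _ , (w∈C , e) , _ ← IsCore.twoNbrs isCore v∈C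
    with w′ , _ , spread ← force-cycle isCore w∈C v∈C (Adj⇒≢ (Adj-sym e))
    = w ∷ w′ ∷ seeds , w ∷ leaves
    -- The seeds `w` and `w′` first blacken the core; from the core and `seeds` the forces of the
    -- certificate then run.
    , (λ u → Forced⇒Black all (Forced-trans (initially w w′ (spread {Forced B (w ∷ w′ ∷ seeds)}
        (closed⇒forcing isCore (Grown-⊇ isCore gr) (λ a∈ a≢v u∈ eu → inj₁ (closed a∈ a≢v u∈ eu)))
        (start (here refl)) (start (there (here refl))))) (forces (all u))))
    , leaves-and-one-general (λ a∈ a≢v eu → closed a∈ a≢v (all _) eu) w∈C (Adj⇒≢ (Adj-sym e))
        leaves∩base (λ x∈ → let z , _ , _ , only = pendants x∈ in z , λ {u} → only (all u))
    , All.¬Any⇒All¬ _ (λ w∈leaves → leaves∩base w∈leaves w∈C) ∷ distinct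
    , s≤s (ℕ.≤-trans (ℕ.≤-reflexive (ℕ.+-comm 1 (length seeds))) bound)
    where
    open Certificate cert
    initially : ∀ w w′ → (∀ {u} → u ∈ C → Forced B (w ∷ w′ ∷ seeds) u) →
                ∀ {u} → u ∈ C ++ seeds → Forced B (w ∷ w′ ∷ seeds) u
    initially w w′ FC u∈ with ∈-++⁻ C u∈
    ... | inj₁ u∈C     = FC u∈C
    ... | inj₂ u∈seeds = start (there (there u∈seeds))

  unicyclic-dominates : V → ConnectedUnicyclic G → Dominates
  unicyclic-dominates a (connected , edges≡n)
    with C , B , isCore , grown , V↭B ← prune n (allFin n) (length-tabulate id) (allFin⁺ n)
           (a , ∈-allFin a) (λ {u} {v} _ _ → Walk⇒Path (proj₂ (connected u v)))
           (≡.trans handshake (cong (2 *_) (≡.trans edges≡n (≡.sym (length-tabulate id)))))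
    = dominates (λ u → ∈-resp-↭ V↭B (∈-allFin u)) isCore grown

theorem2p1 : ∀ {n : ℕ} (G : Graph n) → ConnectedUnicyclic G →
    ∀ g z → IsGPNumber G g → IsZNumber G z → z ≤ g
-- The graph without vertices satisfies the hypothesis; the empty set forces it, so `z` is zero.
theorem2p1 {zero} G unicyclic g z _ (_ , z-min) = ℕ.≤-trans (z-min [] λ ()) z≤n
theorem2p1 {suc n} G unicyclic g z (_ , g-max) (_ , z-min)
  with S , R , S-forces , R-general , R-unique , S≤R ← unicyclic-dominates G zero unicyclic = begin
    z                ≤⟨ z-min (fromList S) S-forces ⟩
    ∣ fromList S ∣   ≤⟨ ∣fromList∣≤length S ⟩
    length S         ≤⟨ S≤R ⟩
    length R         ≤⟨ length≤∣fromList∣ R-unique ⟩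
    ∣ fromList R ∣   ≤⟨ g-max (fromList R) R-general ⟩
    g                ∎
  where open ≤-Reasoning
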